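{- Writing $B_k^{nb}:=B_k^{neobc}$ and $C_k^{nb}:=C_k^{neobc}$, the Pell numbers $P_k$ and Pell-Lucas numbers $Q_k$ satisfy: $$P_{2n}=\frac13\begin{cases}4B^{nb}_{\frac{n+1}{2}}-C^{nb}_{\frac{n+1}{2}}-3 & n\geq1\text{ odd},\\ 20B^{nb}_{\frac{n+2}{2}}-7C^{nb}_{\frac{n+2}{2}}-15 & n\geq2\text{ even},\end{cases}$$ $$P_{2n-1}=\frac16\begin{cases}-16B^{nb}_{\frac{n+1}{2}}+6C^{nb}_{\frac{n+1}{2}}+12 & n\geq1\text{ odd},\\ 20B^{nb}_{\frac{n+2}{2}}-4B^{nb}_{\frac{n}{2}}-7C^{nb}_{\frac{n+2}{2}}+C^{nb}_{\frac{n}{2}}-12 & n\geq2\text{ even},\end{cases}$$ $$Q_{2n}=\frac13\begin{cases}-8B^{nb}_{\frac{n+1}{2}}+4C^{nb}_{\frac{n+1}{2}}+6 & n\geq1\text{ odd},\\ 60B^{nb}_{\frac{n+2}{2}}-4B^{nb}_{\frac{n}{2}}-21C^{nb}_{\frac{n+2}{2}}+C^{nb}_{\frac{n}{2}}-42 & n\geq2\text{ even},\end{cases}$$ $$Q_{2n-1}=\frac13\begin{cases}24B^{nb}_{\frac{n+1}{2}}-8C^{nb}_{\frac{n+1}{2}}-18 & n\geq1\text{ odd},\\ 20B^{nb}_{\frac{n+2}{2}}+4B^{nb}_{\frac{n}{2}}-7C^{nb}_{\frac{n+2}{2}}-C^{nb}_{\frac{n}{2}}-18 & n\geq2\text{ 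even}.\end{cases}$$
   Context: Pell numbers: $P_0=0,P_1=1,P_k=2P_{k-1}+P_{k-2}$; Pell-Lucas numbers: $Q_0=Q_1=2,Q_k=2Q_{k-1}+Q_{k-2}$. A positive integer $m$ is a neo balcobalancing number if there is a positive integer $r$ such that $(1+2+\cdots+(m-1))+(1+2+\cdots+m)=2[(m-1)+m+(m+1)+(m+2)+\cdots+(m+r)]$ (equivalently, $8m^2-12m+9$ is a perfect square). $B_k^{neobc}$ is the $k$-th neo balcobalancing number in increasing order ($k\ge1$) and $C_k^{neobc}=\sqrt{8(B_k^{neobc})^2-12B_k^{neobc}+9}$. -}

module Defs where

open import Data.Nat using (ℕ; zero; suc; _+_; _*_; _∸_; _≤_; _<_)
open import Data.List using (map; upTo)
open import Data.Nat.ListAction using (sum)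
open import Data.Product using (Σ; _×_; ∃)
open import Relation.Binary.PropositionalEquality using (_≡_)
open import Data.Integer as ℤ using (ℤ)

P : ℕ → ℕ
P zero = 0
P (suc zero) = 1
P (suc (suc k)) = 2 * P (suc k) + P k

Q : ℕ → ℕ
Q zero = 2
Q (suc zero) = 2
Q (suc (suc k)) = 2 * Q (suc k) + Q k

IsNeoBalcobalancing : ℕ → Set
IsNeoBalcobalancing m =
  1 ≤ m × Σ ℕ (λ r → 1 ≤ r ×
    (sum (upTo m) + sum (upTo (suc m))
      ≡ 2 * sum (map (λ i → (m ∸ 1) + i) (upTo (r + 2)))))

-- B (indexed from 1) enumerates the neo balcobalancing numbers in increasing order:
-- B 1 < B 2 < ..., each B k (k ≥ 1) is neo balcobalancing, and every
-- neo balcobalancing number is some B k with k ≥ 1.  (B 0 is irrelevant.)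
IsNeoBalcobalancingEnum : (ℕ → ℕ) → Set
IsNeoBalcobalancingEnum B =
  ((k : ℕ) → 1 ≤ k → IsNeoBalcobalancing (B k)) ×
  ((k : ℕ) → 1 ≤ k → B k < B (suc k)) ×
  ((m : ℕ) → IsNeoBalcobalancing m → Σ ℕ (λ k → 1 ≤ k × B k ≡ m))

IsNeoBalcobalancingC : (ℕ → ℕ) → (ℕ → ℕ) → Set
IsNeoBalcobalancingC B C =
  (k : ℕ) → 1 ≤ k →
    ℤ.+ (C k * C k) ≡
      ℤ._+_ (ℤ._-_ (ℤ.+ (8 * (B k * B k))) (ℤ.+ (12 * B k))) (ℤ.+ 9)

{-# OPTIONS --safe #-}

-- Writing r = 1 + s, the balancing equation is m² = (s + 3)(2m + s), and then
-- √(8m² − 12m + 9) = 2m + 2s + 3.  The map (m , s) ↦ (29m + 12s + 6 , 12m + 5s),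
-- which is multiplication by (1 + √2)⁴ on the associated Pell equation, preserves this
-- equation, and its inverse strictly decreases m while keeping m and s nonnegative as
-- long as m > 0.  Hence the solutions are exactly the orbit of (0 , 0), and
-- everything reduces to linear identities along that orbit.
module Submission where

open import Defs
open import Data.Nat using (ℕ; _+_; _*_; _∸_)
open import Data.Integer as ℤ using (ℤ; +_; _-_; -_)
open import Data.Product using (_×_)
open import Relation.Binary.PropositionalEquality using (_≡_)

open import Data.Nat using (zero; suc; _≤_; _<_; _≟_; _≤?_; _<?_; s≤s; z≤n; z<s)
open import Data.Nat.Properties
open import Data.Nat.Induction using (<-wellFounded)
open import Data.Nat.ListAction using (sum)
open import Data.Nat.ListAction.Properties using (sum-++)
open import Data.Nat.Tactic.RingSolver using (solve-∀)
open import Data.List using (map; upTo; [_]; _∷ʳ_)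
open import Data.List.Properties using (upTo-∷ʳ; map-++)
open import Data.Product using (∃; _,_; proj₁; proj₂)
open import Data.Sum using (inj₁; inj₂)
open import Induction.WellFounded using (Acc; acc)
open import Relation.Binary.PropositionalEquality
  using (refl; sym; trans; cong; cong₂; subst; subst₂; module ≡-Reasoning)
open import Relation.Binary.Definitions using (tri<; tri≈; tri>)
open import Relation.Nullary using (yes; no; contradiction)
open import Relation.Nullary.Decidable using (_→-dec_; from-yes)
import Data.Integer.Properties as ℤ
import Data.Integer.Tactic.RingSolver as ℤSolver

-- The balancing equation as a quadratic equation in m and s.

-- The extra `n` on the left keeps the arithmetic series formula free of subtraction.
sum-arithmetic : ∀ a n → 2 * sum (map (λ i → a + i) (upTo n)) + n ≡ n * (2 * a + n)
sum-arithmetic a zero = refl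
sum-arithmetic a (suc n) = begin
  2 * sum (map (λ i → a + i) (upTo (suc n))) + suc n
    ≡⟨ cong (λ l → 2 * sum (map (λ i → a + i) l) + suc n) (sym (upTo-∷ʳ n)) ⟩
  2 * sum (map (λ i → a + i) (upTo n ∷ʳ n)) + suc n
    ≡⟨ cong (λ l → 2 * sum l + suc n) (map-++ (λ i → a + i) (upTo n) [ n ]) ⟩
  2 * sum (map (λ i → a + i) (upTo n) ∷ʳ (a + n)) + suc n
    ≡⟨ cong (λ t → 2 * t + suc n) (sum-++ (map (λ i → a + i) (upTo n)) [ a + n ]) ⟩
  2 * (sum (map (λ i → a + i) (upTo n)) + (a + n + 0)) + suc n
    ≡⟨ split (sum (map (λ i → a + i) (upTo n))) a n ⟩
  (2 * sum (map (λ i → a + i) (upTo n)) + n) + (2 * (a + n) + 1)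
    ≡⟨ cong (_+ (2 * (a + n) + 1)) (sum-arithmetic a n) ⟩
  n * (2 * a + n) + (2 * (a + n) + 1)
    ≡⟨ join a n ⟩
  suc n * (2 * a + suc n) ∎
  where
  open ≡-Reasoning
  split : ∀ t a n → 2 * (t + (a + n + 0)) + suc n ≡ (2 * t + n) + (2 * (a + n) + 1)
  split = solve-∀
  join : ∀ a n → n * (2 * a + n) + (2 * (a + n) + 1) ≡ suc n * (2 * a + suc n)
  join = solve-∀

sum-upTo-suc : ∀ n → sum (upTo (suc n)) ≡ sum (upTo n) + n
sum-upTo-suc n = begin
  sum (upTo (suc n))               ≡⟨ cong sum (sym (upTo-∷ʳ n)) ⟩
  sum (upTo n ∷ʳ n)      ≡⟨ sum-++ (upTo n) [ n ] ⟩
  sum (upTo n) + (n + 0)           ≡⟨ cong (λ t → sum (upTo n) + t) (+-identityʳ n) ⟩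
  sum (upTo n) + n ∎
  where open ≡-Reasoning

-- Passing from m to m + 1 adds m to one sum and m + 1 to the other, which is the gap between
-- consecutive squares.
sum-upTo-square : ∀ m → sum (upTo m) + sum (upTo (suc m)) ≡ m * m
sum-upTo-square zero = refl
sum-upTo-square (suc m) = begin
  sum (upTo (suc m)) + sum (upTo (suc (suc m)))
    ≡⟨ cong₂ _+_ (sum-upTo-suc m) (sum-upTo-suc (suc m)) ⟩
  (sum (upTo m) + m) + (sum (upTo (suc m)) + suc m)
    ≡⟨ split (sum (upTo m)) (sum (upTo (suc m))) m ⟩
  (sum (upTo m) + sum (upTo (suc m))) + (2 * m + 1)
    ≡⟨ cong (_+ (2 * m + 1)) (sum-upTo-square m) ⟩
  m * m + (2 * m + 1)
    ≡⟨ join m ⟩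
  suc m * suc m ∎
  where
  open ≡-Reasoning
  split : ∀ x y m → (x + m) + (y + suc m) ≡ (x + y) + (2 * m + 1)
  split = solve-∀
  join : ∀ m → m * m + (2 * m + 1) ≡ suc m * suc m
  join = solve-∀

Solution : ℕ → ℕ → Set
Solution m s = m * m ≡ (s + 3) * (2 * m + s)

-- Here `a` stands for m - 1, and r = 1 + s makes s + 3 terms starting at m - 1.
balancing-sum : ∀ a s →
  2 * sum (map (λ i → a + i) (upTo (suc s + 2))) ≡ (s + 3) * (2 * suc a + s)
balancing-sum a s = +-cancelʳ-≡ (suc s + 2) _ _
  (trans (sum-arithmetic a (suc s + 2)) (rearrange a s))
  where
  rearrange : ∀ a s →
    (suc s + 2) * (2 * a + (suc s + 2)) ≡ (s + 3) * (2 * suc a + s) + (suc s + 2)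
  rearrange = solve-∀

neo⇒solution : ∀ {m} → IsNeoBalcobalancing m → 1 ≤ m × ∃ (Solution m)
neo⇒solution {suc a} (1≤m , suc s , _ , eq) =
  1≤m , s , trans (sym (sum-upTo-square (suc a))) (trans eq (balancing-sum a s))

solution⇒neo : ∀ {m s} → 1 ≤ m → Solution m s → IsNeoBalcobalancing m
solution⇒neo {suc a} {s} 1≤m sol =
  1≤m , suc s , s≤s z≤n , trans (sum-upTo-square (suc a)) (trans sol (sym (balancing-sum a s)))

-- The orbit of (0 , 0) under the step.

-- Index 0 holds the trivial solution (0 , 0), which positivity excludes from the neo balcobalancing
-- numbers. The count from index 1 therefore agrees with that of `B`: the first values are 6 and
-- 180.
β σ : ℕ → ℕ
β zero    = 0
β (suc k) = 29 * β k + 12 * σ k + 6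
σ zero    = 0
σ (suc k) = 12 * β k + 5 * σ k

-- The amount by which the step raises either side of the `Solution` equation, as a polynomial
-- identity. Because the two sides gain the same amount, the step both preserves and reflects
-- solutions.
step-excess : ℕ → ℕ → ℕ
step-excess m s =
  840 * (m * m) + 696 * (m * s) + 144 * (s * s) + 348 * m + 144 * s + 36

step-lhs : ∀ m s →
  (29 * m + 12 * s + 6) * (29 * m + 12 * s + 6) ≡ m * m + step-excess m s
step-lhs = expand
  where
  expand : ∀ m s → (29 * m + 12 * s + 6) * (29 * m + 12 * s + 6) ≡
    m * m + (840 * (m * m) + 696 * (m * s) + 144 * (s * s) + 348 * m + 144 * s + 36)
  expand = solve-∀

step-rhs : ∀ m s →
  (12 * m + 5 * s + 3) * (2 * (29 * m + 12 * s + 6) + (12 * m + 5 * s)) ≡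
  (s + 3) * (2 * m + s) + step-excess m s
step-rhs = expand
  where
  expand : ∀ m s →
    (12 * m + 5 * s + 3) * (2 * (29 * m + 12 * s + 6) + (12 * m + 5 * s)) ≡
    (s + 3) * (2 * m + s)
      + (840 * (m * m) + 696 * (m * s) + 144 * (s * s) + 348 * m + 144 * s + 36)
  expand = solve-∀

step-solution : ∀ {m s} → Solution m s → Solution (29 * m + 12 * s + 6) (12 * m + 5 * s)
step-solution {m} {s} sol =
  trans (step-lhs m s) (trans (cong (_+ step-excess m s) sol) (sym (step-rhs m s)))

step-solution⁻¹ : ∀ {m s} → Solution (29 * m + 12 * s + 6) (12 * m + 5 * s) → Solution m s
step-solution⁻¹ {m} {s} sol = +-cancelʳ-≡ (step-excess m s) _ _
  (trans (sym (step-lhs m s)) (trans sol (step-rhs m s)))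

orbit-solution : ∀ k → Solution (β k) (σ k)
orbit-solution zero    = refl
orbit-solution (suc k) = step-solution {β k} {σ k} (orbit-solution k)

-- Descent: every solution lies on the orbit.

-- The product on the right contains the term 6 m, and a positive factor m cancels. This permits the
-- substitution m = 6 + u.
solution⇒6≤m : ∀ {m s} → 1 ≤ m → Solution m s → 6 ≤ m
solution⇒6≤m {m@(suc _)} {s} 1≤m sol = *-cancelʳ-≤ 6 m m (begin
  6 * m                                       ≤⟨ m≤m+n (6 * m) _ ⟩
  6 * m + (2 * (m * s) + s * s + 3 * s)       ≡⟨ collect m s ⟩
  (s + 3) * (2 * m + s)                       ≡⟨ sym sol ⟩
  m * m                                       ∎)
  where
  open ≤-Reasoning
  collect : ∀ m s → 6 * m + (2 * (m * s) + s * s + 3 * s) ≡ (s + 3) * (2 * m + s)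
  collect = solve-∀

-- The `Solution` equation for m = 6 + u with 6 u + 36 cancelled on both sides. The shift absorbs
-- the constant 6 of the step, so that (u , s) is a linear image of the predecessor under a matrix
-- of determinant 29 · 5 - 12 · 12 = 1.
Shifted : ℕ → ℕ → Set
Shifted u s = u * u + 6 * u ≡ (2 * u + s) * s + 15 * s

solution⇒shifted : ∀ {u s} → Solution (6 + u) s → Shifted u s
solution⇒shifted {u} {s} sol = +-cancelʳ-≡ (6 * u + 36) _ _
  (trans (lhs u) (trans sol (rhs u s)))
  where
  lhs : ∀ u → u * u + 6 * u + (6 * u + 36) ≡ (6 + u) * (6 + u)
  lhs = solve-∀
  rhs : ∀ u s → (s + 3) * (2 * (6 + u) + s) ≡ (2 * u + s) * s + 15 * s + (6 * u + 36)
  rhs = solve-∀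

-- The right side of the equation grows with s. Scaled by 144 it depends on s only through 12 s, and
-- replacing 12 s by 5 u + 1 already makes it exceed the left side.
shifted⇒12s≤5u : ∀ {u s} → Shifted u s → 12 * s ≤ 5 * u
shifted⇒12s≤5u {u} {s} eq with 12 * s ≤? 5 * u
... | yes le = le
... | no ≰ = contradiction impossible (m+1+n≰m (144 * (u * u + 6 * u)))
  where
  open ≤-Reasoning
  scaleˡ : ∀ u → (24 * u + (1 + 5 * u)) * (1 + 5 * u) + 180 * (1 + 5 * u) ≡
    144 * (u * u + 6 * u) + suc (u * u + 70 * u + 180)
  scaleˡ = solve-∀
  scaleʳ : ∀ u s → (24 * u + 12 * s) * (12 * s) + 180 * (12 * s) ≡
    144 * ((2 * u + s) * s + 15 * s)
  scaleʳ = solve-∀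
  lt : 1 + 5 * u ≤ 12 * s
  lt = ≰⇒> ≰
  impossible : 144 * (u * u + 6 * u) + suc (u * u + 70 * u + 180) ≤ 144 * (u * u + 6 * u)
  impossible = begin
    144 * (u * u + 6 * u) + suc (u * u + 70 * u + 180)
      ≡⟨ sym (scaleˡ u) ⟩
    (24 * u + (1 + 5 * u)) * (1 + 5 * u) + 180 * (1 + 5 * u)
      ≤⟨ +-mono-≤ (*-mono-≤ (+-monoʳ-≤ (24 * u) lt) lt) (*-monoʳ-≤ 180 lt) ⟩
    (24 * u + 12 * s) * (12 * s) + 180 * (12 * s)
      ≡⟨ scaleʳ u s ⟩
    144 * ((2 * u + s) * s + 15 * s)
      ≡⟨ cong (144 *_) (sym eq) ⟩
    144 * (u * u + 6 * u) ∎

-- Decided by evaluating all pairs in the range. The bound on u is the size bound below: scaling the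
-- equation by 841 = 29 · 29 and using 29 s ≤ 12 u gives 841 u² + 5046 u ≤ 840 u² + 5220 u, hence u
-- ≤ 174.
12u≤29s-small : ∀ {u} → u < 175 → ∀ {s} → s < 73 → Shifted u s → 12 * u ≤ 29 * s
12u≤29s-small = from-yes (allUpTo? (λ u → allUpTo? (λ s →
  (u * u + 6 * u ≟ (2 * u + s) * s + 15 * s) →-dec (12 * u ≤? 29 * s)) 73) 175)

-- Comparing sizes only bounds u; the remaining u need integrality, by a finite check.
29s≤12u⇒u≤174 : ∀ {u s} → Shifted u s → 29 * s ≤ 12 * u → u ≤ 174
29s≤12u⇒u≤174 {zero} _ _ = z≤n
29s≤12u⇒u≤174 {u@(suc _)} {s} eq le =
  +-cancelʳ-≤ (840 * u + 5046) u 174 (*-cancelˡ-≤ u (begin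
    u * (u + (840 * u + 5046))
      ≡⟨ scaleˡ u ⟩
    841 * (u * u + 6 * u)
      ≡⟨ cong (841 *_) eq ⟩
    841 * ((2 * u + s) * s + 15 * s)
      ≡⟨ scaleʳ u s ⟩
    (58 * u + 29 * s) * (29 * s) + 435 * (29 * s)
      ≤⟨ +-mono-≤ (*-mono-≤ (+-monoʳ-≤ (58 * u) le) le) (*-monoʳ-≤ 435 le) ⟩
    (58 * u + 12 * u) * (12 * u) + 435 * (12 * u)
      ≡⟨ collect u ⟩
    u * (174 + (840 * u + 5046)) ∎))
  where
  open ≤-Reasoning
  scaleˡ : ∀ u → u * (u + (840 * u + 5046)) ≡ 841 * (u * u + 6 * u)
  scaleˡ = solve-∀
  scaleʳ : ∀ u s → 841 * ((2 * u + s) * s + 15 * s) ≡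
    (58 * u + 29 * s) * (29 * s) + 435 * (29 * s)
  scaleʳ = solve-∀
  collect : ∀ u → (58 * u + 12 * u) * (12 * u) + 435 * (12 * u) ≡ u * (174 + (840 * u + 5046))
  collect = solve-∀

shifted⇒12u≤29s : ∀ {u s} → Shifted u s → 12 * u ≤ 29 * s
shifted⇒12u≤29s {u} {s} eq with 12 * u ≤? 29 * s
... | yes le = le
... | no ≰ = 12u≤29s-small (s≤s u≤174) s<73 eq
  where
  u≤174 : u ≤ 174
  u≤174 = 29s≤12u⇒u≤174 {u} {s} eq (<⇒≤ (≰⇒> ≰))
  s<73 : s < 73
  -- 29 s < 12 u ≤ 12 · 174 = 2088, and 2088 + 29 = 29 · 73.
  s<73 = *-cancelˡ-< 29 s 73
    (<-≤-trans (≰⇒> ≰) (≤-trans (*-monoʳ-≤ 12 u≤174) (m≤m+n 2088 29)))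

-- The inverse matrix gives a = 5 u - 12 s and t = 29 s - 12 u; the two hypotheses say that these
-- are nonnegative.
unstep : ∀ {u s} → 12 * s ≤ 5 * u → 12 * u ≤ 29 * s →
  ∃ λ a → ∃ λ t → u ≡ 29 * a + 12 * t × s ≡ 12 * a + 5 * t
unstep {u} {s} p q with m≤n⇒∃[o]m+o≡n p | m≤n⇒∃[o]m+o≡n q
... | a , a≡ | t , t≡ = a , t ,
  -- The cancelled term collects what is subtracted in 29 (5 u - 12 s) + 12 (29 s - 12 u); the
  -- equation for s is handled the same way.
  +-cancelʳ-≡ (348 * s + 144 * u) _ _ (trans (u-lhs u s)
    (trans (sym (cong₂ (λ x y → 29 * x + 12 * y) a≡ t≡)) (u-rhs u s a t))) ,
  +-cancelʳ-≡ (144 * s + 60 * u) _ _ (trans (s-lhs u s)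
    (trans (sym (cong₂ (λ x y → 12 * x + 5 * y) a≡ t≡)) (s-rhs u s a t)))
  where
  u-lhs : ∀ u s → u + (348 * s + 144 * u) ≡ 29 * (5 * u) + 12 * (29 * s)
  u-lhs = solve-∀
  u-rhs : ∀ u s a t →
    29 * (12 * s + a) + 12 * (12 * u + t) ≡ 29 * a + 12 * t + (348 * s + 144 * u)
  u-rhs = solve-∀
  s-lhs : ∀ u s → s + (144 * s + 60 * u) ≡ 12 * (5 * u) + 5 * (29 * s)
  s-lhs = solve-∀
  s-rhs : ∀ u s a t →
    12 * (12 * s + a) + 5 * (12 * u + t) ≡ 12 * a + 5 * t + (144 * s + 60 * u)
  s-rhs = solve-∀

predecessor : ∀ {m s} → 1 ≤ m → Solution m s →
  ∃ λ a → ∃ λ t → m ≡ 29 * a + 12 * t + 6 × s ≡ 12 * a + 5 * t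
predecessor {m} {s} 1≤m sol with m≤n⇒∃[o]m+o≡n (solution⇒6≤m {m} {s} 1≤m sol)
... | u , refl =
  let shifted = solution⇒shifted {u} {s} sol
      a , t , u≡ , s≡ = unstep (shifted⇒12s≤5u {u} {s} shifted) (shifted⇒12u≤29s {u} {s} shifted)
  in  a , t , trans (+-comm 6 u) (cong (_+ 6) u≡) , s≡

step-increases : ∀ a t → a < 29 * a + 12 * t + 6
step-increases a t = begin-strict
  a                        ≤⟨ m≤n*m a 29 ⟩
  29 * a                   ≤⟨ m≤m+n (29 * a) (12 * t) ⟩
  29 * a + 12 * t          <⟨ m<m+n (29 * a + 12 * t) z<s ⟩
  29 * a + 12 * t + 6      ∎
  where open ≤-Reasoning

0-solution : ∀ {s} → Solution 0 s → s ≡ 0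
0-solution {zero} _ = refl
0-solution {suc s} ()

InOrbit : ℕ → ℕ → Set
InOrbit m s = ∃ λ k → m ≡ β k × s ≡ σ k

step-orbit : ∀ {m s a t} → m ≡ 29 * a + 12 * t + 6 → s ≡ 12 * a + 5 * t →
  InOrbit a t → InOrbit m s
step-orbit refl refl (k , refl , refl) = suc k , refl , refl

-- Well-founded descent on m: a positive m has a smaller predecessor, again a solution since the
-- step reflects solutions, and the descent can stop only at m = 0, where s = 0.
solution⇒orbit : ∀ {m s} → Acc _<_ m → Solution m s → InOrbit m s
solution⇒orbit {zero} {s} _ sol = 0 , refl , 0-solution {s} sol
solution⇒orbit {m@(suc _)} {s} (acc rec) sol = descend (predecessor {m} {s} (s≤s z≤n) sol)
  where
  descend : (∃ λ a → ∃ λ t → m ≡ 29 * a + 12 * t + 6 × s ≡ 12 * a + 5 * t) → InOrbit m s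
  descend (a , t , m≡ , s≡) = step-orbit {m} {s} {a} {t} m≡ s≡
    (solution⇒orbit (rec (subst (a <_) (sym m≡) (step-increases a t)))
      (step-solution⁻¹ {a} {t} (subst₂ Solution m≡ s≡ sol)))

β-increases : ∀ k → β k < β (suc k)
β-increases k = step-increases (β k) (σ k)

-- Uniqueness of increasing enumerations.

Increasing : (ℕ → ℕ) → Set
Increasing f = ∀ k → f k < f (suc k)

increasing⇒mono-< : ∀ {f} → Increasing f → ∀ {i j} → i < j → f i < f j
increasing⇒mono-< inc {i} {suc j} i<1+j with m≤n⇒m<n∨m≡n (≤-pred i<1+j)
... | inj₁ i<j  = <-trans (increasing⇒mono-< inc i<j) (inc j)
... | inj₂ refl = inc i

increasing⇒mono-≤ : ∀ {f} → Increasing f → ∀ {i j} → i ≤ j → f i ≤ f j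
increasing⇒mono-≤ inc i≤j with m≤n⇒m<n∨m≡n i≤j
... | inj₁ i<j  = <⇒≤ (increasing⇒mono-< inc i<j)
... | inj₂ refl = ≤-refl

increasing⇒cancel-< : ∀ {f} → Increasing f → ∀ {i j} → f i < f j → i < j
increasing⇒cancel-< inc {i} {j} fi<fj with i <? j
... | yes i<j = i<j
... | no i≮j  = contradiction fi<fj (≤⇒≯ (increasing⇒mono-≤ inc (≮⇒≥ i≮j)))

increasing⇒inflationary : ∀ {f} → Increasing f → ∀ i → i ≤ f i
increasing⇒inflationary inc zero    = z≤n
increasing⇒inflationary inc (suc i) = ≤-<-trans (increasing⇒inflationary inc i) (inc i)

-- The reindexing i ↦ (index of f i in g) is increasing, hence inflationary.
range-⊆⇒≥ : ∀ {f g} → Increasing f → Increasing g → (∀ i → ∃ λ j → f i ≡ g j) →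
  ∀ i → g i ≤ f i
range-⊆⇒≥ {f} {g} f-inc g-inc f⊆g i = begin
  g i            ≤⟨ increasing⇒mono-≤ g-inc (increasing⇒inflationary index-inc i) ⟩
  g (index i)    ≡⟨ sym (proj₂ (f⊆g i)) ⟩
  f i            ∎
  where
  open ≤-Reasoning
  index : ℕ → ℕ
  index i = proj₁ (f⊆g i)
  index-inc : Increasing index
  index-inc i = increasing⇒cancel-< g-inc
    (subst₂ _<_ (proj₂ (f⊆g i)) (proj₂ (f⊆g (suc i))) (f-inc i))

β-neo : ∀ i → IsNeoBalcobalancing (β (suc i))
β-neo i = solution⇒neo {β (suc i)} {σ (suc i)}
  (≤-<-trans z≤n (β-increases i)) (orbit-solution (suc i))

orbit⇒β : ∀ {m s} → 1 ≤ m → InOrbit m s → ∃ λ i → m ≡ β (suc i)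
orbit⇒β ()  (zero  , refl , _)
orbit⇒β 1≤m (suc i , m≡   , _) = i , m≡

neo⇒β : ∀ {m} → IsNeoBalcobalancing m → ∃ λ i → m ≡ β (suc i)
neo⇒β {m} neo =
  let 1≤m , s , sol = neo⇒solution neo
  in  orbit⇒β {m} {s} 1≤m (solution⇒orbit {m} {s} (<-wellFounded m) sol)

-- From index 1 on, `B` and `β` are increasing with the same range, so each bounds the other
-- pointwise.
enum≡β : ∀ {B} → IsNeoBalcobalancingEnum B → ∀ i → B (suc i) ≡ β (suc i)
enum≡β {B} (B-neo , B-inc , B-onto) i =
  ≤-antisym (range-⊆⇒≥ β-inc B-inc′ β⊆B i) (range-⊆⇒≥ B-inc′ β-inc B⊆β i)
  where
  B-inc′ : Increasing (λ i → B (suc i))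
  B-inc′ i = B-inc (suc i) (s≤s z≤n)
  β-inc : Increasing (λ i → β (suc i))
  β-inc i = β-increases (suc i)
  positive-index : ∀ {m} → (∃ λ k → 1 ≤ k × B k ≡ m) → ∃ λ j → m ≡ B (suc j)
  positive-index (suc j , _ , Bk≡m) = j , sym Bk≡m
  β⊆B : ∀ i → ∃ λ j → β (suc i) ≡ B (suc j)
  β⊆B i = positive-index (B-onto (β (suc i)) (β-neo i))
  B⊆β : ∀ i → ∃ λ j → B (suc i) ≡ β (suc j)
  B⊆β i = neo⇒β (B-neo (suc i) (s≤s z≤n))

-- The square root C along the orbit.

square-injective : ∀ {x y} → x * x ≡ y * y → x ≡ y
square-injective {x} {y} eq with <-cmp x y
... | tri< x<y _ _ = contradiction eq (<⇒≢ (*-mono-< x<y x<y))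
... | tri≈ _ x≡y _ = x≡y
... | tri> _ _ y<x = contradiction (sym eq) (<⇒≢ (*-mono-< y<x y<x))

-- Together with 12 m, the terms of the expanded square that involve s make up 4 (s + 3)(2 m + s),
-- which the `Solution` equation turns into 4 m².
solution-square : ∀ {m s} → Solution m s →
  (2 * m + 2 * s + 3) * (2 * m + 2 * s + 3) + 12 * m ≡ 8 * (m * m) + 9
solution-square {m} {s} sol = begin
  (2 * m + 2 * s + 3) * (2 * m + 2 * s + 3) + 12 * m
    ≡⟨ expand m s ⟩
  4 * (m * m) + 4 * ((s + 3) * (2 * m + s)) + 9
    ≡⟨ cong (λ t → 4 * (m * m) + 4 * t + 9) (sym sol) ⟩
  4 * (m * m) + 4 * (m * m) + 9
    ≡⟨ collect (m * m) ⟩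
  8 * (m * m) + 9 ∎
  where
  open ≡-Reasoning
  expand : ∀ m s → (2 * m + 2 * s + 3) * (2 * m + 2 * s + 3) + 12 * m ≡
    4 * (m * m) + 4 * ((s + 3) * (2 * m + s)) + 9
  expand = solve-∀
  collect : ∀ q → 4 * q + 4 * q + 9 ≡ 8 * q + 9
  collect = solve-∀

-- The hypothesis on `C` gives its square over ℤ. Adding 12 m to both sides brings the equation back
-- to ℕ, where squaring is injective.
enumC≡ : ∀ {B C} → IsNeoBalcobalancingEnum B → IsNeoBalcobalancingC B C →
  ∀ i → C (suc i) ≡ 2 * β (suc i) + 2 * σ (suc i) + 3
enumC≡ {B} {C} enum isC i = square-injective (+-cancelʳ-≡ (12 * m) _ _
  (trans (ℤ.+-injective C²) (sym (solution-square {m} {σ (suc i)} (orbit-solution (suc i))))))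
  where
  m c : ℕ
  m = β (suc i)
  c = C (suc i)
  cancel : ∀ x y → x - y ℤ.+ + 9 ℤ.+ y ≡ x ℤ.+ + 9
  cancel = ℤSolver.solve-∀
  C² : + (c * c + 12 * m) ≡ + (8 * (m * m) + 9)
  C² = begin
    + (c * c) ℤ.+ + (12 * m)
      ≡⟨ cong (ℤ._+ + (12 * m)) (subst
           (λ b → + (c * c) ≡ + (8 * (b * b)) - + (12 * b) ℤ.+ + 9)
           (enum≡β enum i) (isC (suc i) (s≤s z≤n))) ⟩
    + (8 * (m * m)) - + (12 * m) ℤ.+ + 9 ℤ.+ + (12 * m)
      ≡⟨ cancel (+ (8 * (m * m))) (+ (12 * m)) ⟩
    + (8 * (m * m)) ℤ.+ + 9 ∎
    where open ≡-Reasoning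

-- Pell and Pell-Lucas numbers along the orbit.

-- One orbit step is multiplication by (1 + √2)⁴, so it matches four steps of the Pell recurrence.
-- The coefficients are `P 3` and `P 4`, and in the next lemma `P 4` and `P 5`.
P-4+ : ∀ n → P (4 + n) ≡ 5 * P n + 12 * P (1 + n)
P-4+ n = unfold (P n) (P (1 + n))
  where
  unfold : ∀ x y → 2 * (2 * (2 * y + x) + y) + (2 * y + x) ≡ 5 * x + 12 * y
  unfold = solve-∀

P-5+ : ∀ n → P (5 + n) ≡ 12 * P n + 29 * P (1 + n)
P-5+ n = trans (P-4+ (suc n)) (unfold (P n) (P (1 + n)))
  where
  unfold : ∀ x y → 5 * y + 12 * (2 * y + x) ≡ 12 * x + 29 * y
  unfold = solve-∀

-- Two consecutive Pell numbers are carried together because advancing either of them by four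
-- indices uses both.
pell-orbit : ∀ j →
  3 * P (4 * j) ≡ 6 * β j + 2 * σ j × 3 * P (1 + 4 * j) ≡ 14 * β j + 6 * σ j + 3
pell-orbit zero = refl , refl
pell-orbit (suc j) =
    (begin
      3 * P (4 * suc j)
        ≡⟨ cong (λ n → 3 * P n) (*-suc 4 j) ⟩
      3 * P (4 + 4 * j)
        ≡⟨ cong (3 *_) (P-4+ (4 * j)) ⟩
      3 * (5 * P (4 * j) + 12 * P (1 + 4 * j))
        ≡⟨ distrib 5 12 (P (4 * j)) (P (1 + 4 * j)) ⟩
      5 * (3 * P (4 * j)) + 12 * (3 * P (1 + 4 * j))
        ≡⟨ cong₂ (λ x y → 5 * x + 12 * y) (proj₁ (pell-orbit j)) (proj₂ (pell-orbit j)) ⟩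
      5 * (6 * β j + 2 * σ j) + 12 * (14 * β j + 6 * σ j + 3)
        ≡⟨ collect₀ (β j) (σ j) ⟩
      6 * β (suc j) + 2 * σ (suc j) ∎) ,
    (begin
      3 * P (1 + 4 * suc j)
        ≡⟨ cong (λ n → 3 * P (1 + n)) (*-suc 4 j) ⟩
      3 * P (5 + 4 * j)
        ≡⟨ cong (3 *_) (P-5+ (4 * j)) ⟩
      3 * (12 * P (4 * j) + 29 * P (1 + 4 * j))
        ≡⟨ distrib 12 29 (P (4 * j)) (P (1 + 4 * j)) ⟩
      12 * (3 * P (4 * j)) + 29 * (3 * P (1 + 4 * j))
        ≡⟨ cong₂ (λ x y → 12 * x + 29 * y) (proj₁ (pell-orbit j)) (proj₂ (pell-orbit j)) ⟩
      12 * (6 * β j + 2 * σ j) + 29 * (14 * β j + 6 * σ j + 3)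
        ≡⟨ collect₁ (β j) (σ j) ⟩
      14 * β (suc j) + 6 * σ (suc j) + 3 ∎)
  where
  open ≡-Reasoning
  distrib : ∀ u v x y → 3 * (u * x + v * y) ≡ u * (3 * x) + v * (3 * y)
  distrib = solve-∀
  collect₀ : ∀ b s → 5 * (6 * b + 2 * s) + 12 * (14 * b + 6 * s + 3) ≡
    6 * (29 * b + 12 * s + 6) + 2 * (12 * b + 5 * s)
  collect₀ = solve-∀
  collect₁ : ∀ b s → 12 * (6 * b + 2 * s) + 29 * (14 * b + 6 * s + 3) ≡
    14 * (29 * b + 12 * s + 6) + 6 * (12 * b + 5 * s) + 3
  collect₁ = solve-∀

-- Both sides satisfy the Pell recurrence and agree at 0 and 1. This is Q = 2 (P⁺ - P), with P⁺ the
-- next Pell number, written without subtraction.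
Q+2P : ∀ n → Q n + 2 * P n ≡ 2 * P (suc n)
Q+2P zero = refl
Q+2P (suc zero) = refl
Q+2P (suc (suc n)) = begin
  2 * Q (suc n) + Q n + 2 * (2 * P (suc n) + P n)
    ≡⟨ split (Q (suc n)) (Q n) (P (suc n)) (P n) ⟩
  2 * (Q (suc n) + 2 * P (suc n)) + (Q n + 2 * P n)
    ≡⟨ cong₂ (λ x y → 2 * x + y) (Q+2P (suc n)) (Q+2P n) ⟩
  2 * (2 * P (suc (suc n))) + 2 * P (suc n)
    ≡⟨ join (P (suc (suc n))) (P (suc n)) ⟩
  2 * (2 * P (suc (suc n)) + P (suc n)) ∎
  where
  open ≡-Reasoning
  split : ∀ a b c d → 2 * a + b + 2 * (2 * c + d) ≡ 2 * (a + 2 * c) + (b + 2 * d)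
  split = solve-∀
  join : ∀ x y → 2 * (2 * x) + 2 * y ≡ 2 * (2 * x + y)
  join = solve-∀

-- Affine forms are kept as coefficient triples so that the recurrences act on numerals and the new
-- coefficients are found by evaluation.
lin : (x y z j : ℕ) → ℕ
lin x y z j = x * β j + y * σ j + z

lin-rec : ∀ x y z x′ y′ z′ j {p q} → 3 * p ≡ lin x y z j → 3 * q ≡ lin x′ y′ z′ j →
  3 * (2 * p + q) ≡ lin (2 * x + x′) (2 * y + y′) (2 * z + z′) j
lin-rec x y z x′ y′ z′ j {p} {q} p≡ q≡ = trans (split p q)
  (trans (cong₂ (λ u v → 2 * u + v) p≡ q≡) (collect x y z x′ y′ z′ (β j) (σ j)))
  where
  split : ∀ p q → 3 * (2 * p + q) ≡ 2 * (3 * p) + 3 * q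
  split = solve-∀
  collect : ∀ x y z x′ y′ z′ b s →
    2 * (x * b + y * s + z) + (x′ * b + y′ * s + z′) ≡
    (2 * x + x′) * b + (2 * y + y′) * s + (2 * z + z′)
  collect = solve-∀

-- A Pell-Lucas number is twice the difference of two consecutive Pell numbers; passing the
-- increments of the coefficients as arguments avoids subtracting them.
lin-Q : ∀ x y z dx dy dz j n →
  3 * P n ≡ lin x y z j → 3 * P (suc n) ≡ lin (x + dx) (y + dy) (z + dz) j →
  3 * Q n ≡ lin (2 * dx) (2 * dy) (2 * dz) j
lin-Q x y z dx dy dz j n p≡ p′≡ = +-cancelʳ-≡ (2 * lin x y z j) _ _ (begin
  3 * Q n + 2 * lin x y z j
    ≡⟨ cong (λ t → 3 * Q n + 2 * t) (sym p≡) ⟩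
  3 * Q n + 2 * (3 * P n)
    ≡⟨ gather (Q n) (P n) ⟩
  3 * (Q n + 2 * P n)
    ≡⟨ cong (3 *_) (Q+2P n) ⟩
  3 * (2 * P (suc n))
    ≡⟨ swap (P (suc n)) ⟩
  2 * (3 * P (suc n))
    ≡⟨ cong (2 *_) p′≡ ⟩
  2 * lin (x + dx) (y + dy) (z + dz) j
    ≡⟨ split x y z dx dy dz (β j) (σ j) ⟩
  lin (2 * dx) (2 * dy) (2 * dz) j + 2 * lin x y z j ∎)
  where
  open ≡-Reasoning
  gather : ∀ q p → 3 * q + 2 * (3 * p) ≡ 3 * (q + 2 * p)
  gather = solve-∀
  swap : ∀ p → 3 * (2 * p) ≡ 2 * (3 * p)
  swap = solve-∀
  split : ∀ x y z dx dy dz b s → 2 * ((x + dx) * b + (y + dy) * s + (z + dz)) ≡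
    (2 * dx) * b + (2 * dy) * s + 2 * dz + 2 * (x * b + y * s + z)
  split = solve-∀

-- Passage to integer affine forms.

affine : (x y z : ℕ) (b s : ℤ) → ℤ
affine x y z b s = + x ℤ.* b ℤ.+ + y ℤ.* s ℤ.+ + z

pos-lin : ∀ x y z j → + lin x y z j ≡ affine x y z (+ β j) (+ σ j)
pos-lin x y z j = cong₂ (λ u v → u ℤ.+ v ℤ.+ + z) (ℤ.pos-* x (β j)) (ℤ.pos-* y (σ j))

pos-triple : ∀ n x y z j → 3 * n ≡ lin x y z j → + 3 ℤ.* + n ≡ affine x y z (+ β j) (+ σ j)
pos-triple n x y z j eq =
  trans (sym (ℤ.pos-* 3 n)) (trans (cong +_ eq) (pos-lin x y z j))

-- Serves the formulas for Pell numbers of odd index, whose denominator is 6 instead of 3.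
pos-sextuple : ∀ n x y z j → 3 * n ≡ lin x y z j →
  + 6 ℤ.* + n ≡ + 2 ℤ.* affine x y z (+ β j) (+ σ j)
pos-sextuple n x y z j eq =
  trans (ℤ.*-assoc (+ 2) (+ 3) (+ n)) (cong (+ 2 ℤ.*_) (pos-triple n x y z j eq))

module _ {B C : ℕ → ℕ} (enum : IsNeoBalcobalancingEnum B) (isC : IsNeoBalcobalancingC B C)
         (j : ℕ) where

  -- The coefficients for `B` are those of the step applied once for index j + 1 and twice for j +
  -- 2; those for `C` follow from 2 m + 2 s + 3.
  B-affine₁ : + B (j + 1) ≡ affine 29 12 6 (+ β j) (+ σ j)
  B-affine₁ = trans (cong (λ n → + B n) (+-comm j 1))
    (trans (cong +_ (enum≡β {B} enum j)) (pos-lin 29 12 6 j))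

  C-affine₁ : + C (j + 1) ≡ affine 82 34 15 (+ β j) (+ σ j)
  C-affine₁ = trans (cong (λ n → + C n) (+-comm j 1))
    (trans (cong +_ (trans (enumC≡ {B} {C} enum isC j) (collect (β j) (σ j))))
      (pos-lin 82 34 15 j))
    where
    collect : ∀ b s →
      2 * (29 * b + 12 * s + 6) + 2 * (12 * b + 5 * s) + 3 ≡ 82 * b + 34 * s + 15
    collect = solve-∀

  B-affine₂ : + B (j + 2) ≡ affine 985 408 180 (+ β j) (+ σ j)
  B-affine₂ = trans (cong (λ n → + B n) (+-comm j 2))
    (trans (cong +_ (trans (enum≡β {B} enum (1 + j)) (collect (β j) (σ j))))
      (pos-lin 985 408 180 j))
    where
    collect : ∀ b s →
      29 * (29 * b + 12 * s + 6) + 12 * (12 * b + 5 * s) + 6 ≡ 985 * b + 408 * s + 180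
    collect = solve-∀

  C-affine₂ : + C (j + 2) ≡ affine 2786 1154 507 (+ β j) (+ σ j)
  C-affine₂ = trans (cong (λ n → + C n) (+-comm j 2))
    (trans (cong +_ (trans (enumC≡ {B} {C} enum isC (1 + j)) (collect (β j) (σ j))))
      (pos-lin 2786 1154 507 j))
    where
    collect : ∀ b s →
      2 * (29 * (29 * b + 12 * s + 6) + 12 * (12 * b + 5 * s) + 6)
        + 2 * (12 * (29 * b + 12 * s + 6) + 5 * (12 * b + 5 * s)) + 3 ≡
      2786 * b + 1154 * s + 507
    collect = solve-∀

-- The left sides begin with successors, so that `∸ 1` reduces when the equations are used for the
-- odd indices.
odd-index : ∀ j → 2 + 4 * j ≡ 2 * (2 * j + 1)
odd-index = solve-∀

even-index : ∀ j → 4 + 4 * j ≡ 2 * (2 * j + 2)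
even-index = solve-∀

module _ (j : ℕ) where

  P-lin₀ : 3 * P (4 * j) ≡ lin 6 2 0 j
  P-lin₀ = trans (proj₁ (pell-orbit j)) (sym (+-identityʳ _))
  P-lin₁ : 3 * P (1 + 4 * j) ≡ lin 14 6 3 j
  P-lin₁ = proj₂ (pell-orbit j)
  P-lin₂ : 3 * P (2 + 4 * j) ≡ lin 34 14 6 j
  P-lin₂ = lin-rec 14 6 3 6 2 0 j {P (1 + 4 * j)} {P (4 * j)} P-lin₁ P-lin₀
  P-lin₃ : 3 * P (3 + 4 * j) ≡ lin 82 34 15 j
  P-lin₃ = lin-rec 34 14 6 14 6 3 j {P (2 + 4 * j)} {P (1 + 4 * j)} P-lin₂ P-lin₁
  P-lin₄ : 3 * P (4 + 4 * j) ≡ lin 198 82 36 j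
  P-lin₄ = lin-rec 82 34 15 34 14 6 j {P (3 + 4 * j)} {P (2 + 4 * j)} P-lin₃ P-lin₂

  Q-lin₁ : 3 * Q (1 + 4 * j) ≡ lin 40 16 6 j
  Q-lin₁ = lin-Q 14 6 3 20 8 3 j (1 + 4 * j) P-lin₁ P-lin₂
  Q-lin₂ : 3 * Q (2 + 4 * j) ≡ lin 96 40 18 j
  Q-lin₂ = lin-Q 34 14 6 48 20 9 j (2 + 4 * j) P-lin₂ P-lin₃
  Q-lin₃ : 3 * Q (3 + 4 * j) ≡ lin 232 96 42 j
  Q-lin₃ = lin-rec 96 40 18 40 16 6 j {Q (2 + 4 * j)} {Q (1 + 4 * j)} Q-lin₂ Q-lin₁
  Q-lin₄ : 3 * Q (4 + 4 * j) ≡ lin 560 232 102 j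
  Q-lin₄ = lin-rec 232 96 42 96 40 18 j {Q (3 + 4 * j)} {Q (2 + 4 * j)} Q-lin₃ Q-lin₂

-- The eight linear identities.

-- Subscripts here and below give the offset of the index from 4 j. Matching the hypotheses with
-- `refl` puts in the affine forms and leaves an identity over ℤ in `b` and `s` alone.
P₂-formula : ∀ b s {u B C} → u ≡ affine 34 14 6 b s →
  B ≡ affine 29 12 6 b s → C ≡ affine 82 34 15 b s →
  u ≡ + 4 ℤ.* B - C - + 3
P₂-formula b s refl refl refl = identity b s
  where
  identity : ∀ b s →
    + 34 ℤ.* b ℤ.+ + 14 ℤ.* s ℤ.+ + 6 ≡
    + 4 ℤ.* (+ 29 ℤ.* b ℤ.+ + 12 ℤ.* s ℤ.+ + 6)
      - (+ 82 ℤ.* b ℤ.+ + 34 ℤ.* s ℤ.+ + 15) - + 3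
  identity = ℤSolver.solve-∀

P₁-formula : ∀ b s {u B C} → u ≡ + 2 ℤ.* affine 14 6 3 b s →
  B ≡ affine 29 12 6 b s → C ≡ affine 82 34 15 b s →
  u ≡ - (+ 16) ℤ.* B ℤ.+ + 6 ℤ.* C ℤ.+ + 12
P₁-formula b s refl refl refl = identity b s
  where
  identity : ∀ b s →
    + 2 ℤ.* (+ 14 ℤ.* b ℤ.+ + 6 ℤ.* s ℤ.+ + 3) ≡
    - (+ 16) ℤ.* (+ 29 ℤ.* b ℤ.+ + 12 ℤ.* s ℤ.+ + 6)
      ℤ.+ + 6 ℤ.* (+ 82 ℤ.* b ℤ.+ + 34 ℤ.* s ℤ.+ + 15) ℤ.+ + 12
  identity = ℤSolver.solve-∀

Q₂-formula : ∀ b s {u B C} → u ≡ affine 96 40 18 b s →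
  B ≡ affine 29 12 6 b s → C ≡ affine 82 34 15 b s →
  u ≡ - (+ 8) ℤ.* B ℤ.+ + 4 ℤ.* C ℤ.+ + 6
Q₂-formula b s refl refl refl = identity b s
  where
  identity : ∀ b s →
    + 96 ℤ.* b ℤ.+ + 40 ℤ.* s ℤ.+ + 18 ≡
    - (+ 8) ℤ.* (+ 29 ℤ.* b ℤ.+ + 12 ℤ.* s ℤ.+ + 6)
      ℤ.+ + 4 ℤ.* (+ 82 ℤ.* b ℤ.+ + 34 ℤ.* s ℤ.+ + 15) ℤ.+ + 6
  identity = ℤSolver.solve-∀

Q₁-formula : ∀ b s {u B C} → u ≡ affine 40 16 6 b s →
  B ≡ affine 29 12 6 b s → C ≡ affine 82 34 15 b s →
  u ≡ + 24 ℤ.* B - + 8 ℤ.* C - + 18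
Q₁-formula b s refl refl refl = identity b s
  where
  identity : ∀ b s →
    + 40 ℤ.* b ℤ.+ + 16 ℤ.* s ℤ.+ + 6 ≡
    + 24 ℤ.* (+ 29 ℤ.* b ℤ.+ + 12 ℤ.* s ℤ.+ + 6)
      - + 8 ℤ.* (+ 82 ℤ.* b ℤ.+ + 34 ℤ.* s ℤ.+ + 15) - + 18
  identity = ℤSolver.solve-∀

P₄-formula : ∀ b s {u B′ C′} → u ≡ affine 198 82 36 b s →
  B′ ≡ affine 985 408 180 b s → C′ ≡ affine 2786 1154 507 b s →
  u ≡ + 20 ℤ.* B′ - + 7 ℤ.* C′ - + 15
P₄-formula b s refl refl refl = identity b s
  where
  identity : ∀ b s →
    + 198 ℤ.* b ℤ.+ + 82 ℤ.* s ℤ.+ + 36 ≡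
    + 20 ℤ.* (+ 985 ℤ.* b ℤ.+ + 408 ℤ.* s ℤ.+ + 180)
      - + 7 ℤ.* (+ 2786 ℤ.* b ℤ.+ + 1154 ℤ.* s ℤ.+ + 507) - + 15
  identity = ℤSolver.solve-∀

P₃-formula : ∀ b s {u B C B′ C′} → u ≡ + 2 ℤ.* affine 82 34 15 b s →
  B ≡ affine 29 12 6 b s → C ≡ affine 82 34 15 b s →
  B′ ≡ affine 985 408 180 b s → C′ ≡ affine 2786 1154 507 b s →
  u ≡ + 20 ℤ.* B′ - + 4 ℤ.* B - + 7 ℤ.* C′ ℤ.+ C - + 12
P₃-formula b s refl refl refl refl refl = identity b s
  where
  identity : ∀ b s →
    + 2 ℤ.* (+ 82 ℤ.* b ℤ.+ + 34 ℤ.* s ℤ.+ + 15) ≡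
    + 20 ℤ.* (+ 985 ℤ.* b ℤ.+ + 408 ℤ.* s ℤ.+ + 180)
      - + 4 ℤ.* (+ 29 ℤ.* b ℤ.+ + 12 ℤ.* s ℤ.+ + 6)
      - + 7 ℤ.* (+ 2786 ℤ.* b ℤ.+ + 1154 ℤ.* s ℤ.+ + 507)
      ℤ.+ (+ 82 ℤ.* b ℤ.+ + 34 ℤ.* s ℤ.+ + 15) - + 12
  identity = ℤSolver.solve-∀

Q₄-formula : ∀ b s {u B C B′ C′} → u ≡ affine 560 232 102 b s →
  B ≡ affine 29 12 6 b s → C ≡ affine 82 34 15 b s →
  B′ ≡ affine 985 408 180 b s → C′ ≡ affine 2786 1154 507 b s →
  u ≡ + 60 ℤ.* B′ - + 4 ℤ.* B - + 21 ℤ.* C′ ℤ.+ C - + 42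
Q₄-formula b s refl refl refl refl refl = identity b s
  where
  identity : ∀ b s →
    + 560 ℤ.* b ℤ.+ + 232 ℤ.* s ℤ.+ + 102 ≡
    + 60 ℤ.* (+ 985 ℤ.* b ℤ.+ + 408 ℤ.* s ℤ.+ + 180)
      - + 4 ℤ.* (+ 29 ℤ.* b ℤ.+ + 12 ℤ.* s ℤ.+ + 6)
      - + 21 ℤ.* (+ 2786 ℤ.* b ℤ.+ + 1154 ℤ.* s ℤ.+ + 507)
      ℤ.+ (+ 82 ℤ.* b ℤ.+ + 34 ℤ.* s ℤ.+ + 15) - + 42
  identity = ℤSolver.solve-∀

Q₃-formula : ∀ b s {u B C B′ C′} → u ≡ affine 232 96 42 b s →
  B ≡ affine 29 12 6 b s → C ≡ affine 82 34 15 b s →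
  B′ ≡ affine 985 408 180 b s → C′ ≡ affine 2786 1154 507 b s →
  u ≡ + 20 ℤ.* B′ ℤ.+ + 4 ℤ.* B - + 7 ℤ.* C′ - C - + 18
Q₃-formula b s refl refl refl refl refl = identity b s
  where
  identity : ∀ b s →
    + 232 ℤ.* b ℤ.+ + 96 ℤ.* s ℤ.+ + 42 ≡
    + 20 ℤ.* (+ 985 ℤ.* b ℤ.+ + 408 ℤ.* s ℤ.+ + 180)
      ℤ.+ + 4 ℤ.* (+ 29 ℤ.* b ℤ.+ + 12 ℤ.* s ℤ.+ + 6)
      - + 7 ℤ.* (+ 2786 ℤ.* b ℤ.+ + 1154 ℤ.* s ℤ.+ + 507)
      - (+ 82 ℤ.* b ℤ.+ + 34 ℤ.* s ℤ.+ + 15) - + 18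
  identity = ℤSolver.solve-∀

-- One `j` covers both parities. For n = 2 j + 1 the index (n + 1)/2 is j + 1; for n = 2 j + 2 the
-- indices (n + 2)/2 and n/2 are j + 2 and j + 1. Denominators are cleared.
theorem5p3 : (B C : ℕ → ℕ) → IsNeoBalcobalancingEnum B → IsNeoBalcobalancingC B C →
    (j : ℕ) →
    ((+ 3 ℤ.* + P (2 * (2 * j + 1)) ≡ + 4 ℤ.* + B (j + 1) - + C (j + 1) - + 3)
    × (+ 6 ℤ.* + P (2 * (2 * j + 1) ∸ 1) ≡ - (+ 16) ℤ.* + B (j + 1) ℤ.+ + 6 ℤ.* + C (j + 1) ℤ.+ + 12)
    × (+ 3 ℤ.* + Q (2 * (2 * j + 1)) ≡ - (+ 8) ℤ.* + B (j + 1) ℤ.+ + 4 ℤ.* + C (j + 1) ℤ.+ + 6)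
    × (+ 3 ℤ.* + Q (2 * (2 * j + 1) ∸ 1) ≡ + 24 ℤ.* + B (j + 1) - + 8 ℤ.* + C (j + 1) - + 18))
    × ((+ 3 ℤ.* + P (2 * (2 * j + 2)) ≡ + 20 ℤ.* + B (j + 2) - + 7 ℤ.* + C (j + 2) - + 15)
    × (+ 6 ℤ.* + P (2 * (2 * j + 2) ∸ 1)
    ≡ + 20 ℤ.* + B (j + 2) - + 4 ℤ.* + B (j + 1) - + 7 ℤ.* + C (j + 2) ℤ.+ + C (j + 1) - + 12)
    × (+ 3 ℤ.* + Q (2 * (2 * j + 2))
    ≡ + 60 ℤ.* + B (j + 2) - + 4 ℤ.* + B (j + 1) - + 21 ℤ.* + C (j + 2) ℤ.+ + C (j + 1) - + 42)
    × (+ 3 ℤ.* + Q (2 * (2 * j + 2) ∸ 1)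
    ≡ + 20 ℤ.* + B (j + 2) ℤ.+ + 4 ℤ.* + B (j + 1) - + 7 ℤ.* + C (j + 2) - + C (j + 1) - + 18))
theorem5p3 B C enum isC j =
    ( P₂-formula b s (pos-triple (P (2 * (2 * j + 1))) 34 14 6 j
        (subst (λ n → 3 * P n ≡ lin 34 14 6 j) (odd-index j) (P-lin₂ j))) B₁ C₁
    , P₁-formula b s (pos-sextuple (P (2 * (2 * j + 1) ∸ 1)) 14 6 3 j
        (subst (λ n → 3 * P (n ∸ 1) ≡ lin 14 6 3 j) (odd-index j) (P-lin₁ j))) B₁ C₁
    , Q₂-formula b s (pos-triple (Q (2 * (2 * j + 1))) 96 40 18 j
        (subst (λ n → 3 * Q n ≡ lin 96 40 18 j) (odd-index j) (Q-lin₂ j))) B₁ C₁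
    , Q₁-formula b s (pos-triple (Q (2 * (2 * j + 1) ∸ 1)) 40 16 6 j
        (subst (λ n → 3 * Q (n ∸ 1) ≡ lin 40 16 6 j) (odd-index j) (Q-lin₁ j))) B₁ C₁)
  , ( P₄-formula b s (pos-triple (P (2 * (2 * j + 2))) 198 82 36 j
        (subst (λ n → 3 * P n ≡ lin 198 82 36 j) (even-index j) (P-lin₄ j))) B₂ C₂
    , P₃-formula b s (pos-sextuple (P (2 * (2 * j + 2) ∸ 1)) 82 34 15 j
        (subst (λ n → 3 * P (n ∸ 1) ≡ lin 82 34 15 j) (even-index j) (P-lin₃ j))) B₁ C₁ B₂ C₂
    , Q₄-formula b s (pos-triple (Q (2 * (2 * j + 2))) 560 232 102 j
        (subst (λ n → 3 * Q n ≡ lin 560 232 102 j) (even-index j) (Q-lin₄ j))) B₁ C₁ B₂ C₂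
    , Q₃-formula b s (pos-triple (Q (2 * (2 * j + 2) ∸ 1)) 232 96 42 j
        (subst (λ n → 3 * Q (n ∸ 1) ≡ lin 232 96 42 j) (even-index j) (Q-lin₃ j))) B₁ C₁ B₂ C₂)
  where
  b s : ℤ
  b = + β j
  s = + σ j
  B₁ = B-affine₁ {B} {C} enum isC j
  C₁ = C-affine₁ {B} {C} enum isC j
  B₂ = B-affine₂ {B} {C} enum isC j
  C₂ = C-affine₂ {B} {C} enum isC j
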